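{- Let $E(m,n)$ denote the expected number of rounds in Urn Solitaire started with $m$ green and $n$ red balls (equivalently, the function determined by the recurrence given in the context). Then for all integers $m\ge 1$ and $n\ge 1$, $$ 2(m+2)(m+1)(2mn+2m+7n+9)(m+3)\,E(m,n) $$ $$ -(m+3)(m+2)\bigl(14m^2n+6mn^2+14m^2+83mn+21n^2+91m+123n+128\bigr)\,E(m+1,n) $$ $$ +(m+3)\bigl(18m^3n+16m^2n^2+2mn^3+18m^3+167m^2n+94mn^2+7n^3+169m^2+521mn+132n^2+511m+537n+508\bigr)\,E(m+2,n) $$ $$ +\bigl(-10m^4n-14m^3n^2-4m^2n^3-10m^4-135m^3n-129m^2n^2-24mn^3-131m^3-684m^2n-393mn^2-34n^3-639m^2-1535mn-396n^2-1380m-1286n-1116\bigr)\,E(m+3,n) $$ $$ +(m+3)(2mn+2m+5n+7)(m+n+4)(m+n+3)\,E(m+4,n)=0 . $$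
   Context: Urn Solitaire: an urn contains $m$ green and $n$ red balls. A round consists of drawing balls uniformly at random without replacement, noting the color of the first ball, and continuing to draw until a ball of the other color is drawn; that last ball is returned to the urn. Rounds are repeated, and the game is considered over as soon as the urn contains balls of only one color (or is empty). $E(m,n)$ is the expected number of rounds until the game is over. Equivalently, $E(m,0)=E(0,n)=0$ for all $m,n\ge 0$, and for $m,n\ge 1$, $$E(m,n)=1+\sum_{k=1}^{m}\frac{\binom{m}{k}}{\binom{m+n}{k}}\cdot\frac{n}{m+n-k}\,E(m-k,n)+\sum_{k=1}^{n}\frac{\binom{n}{k}}{\binom{m+n}{k}}\cdot\frac{m}{m+n-k}\,E(m,n-k).$$ -}

module Defs where

open import Data.Nat using (ℕ; zero; suc) renaming (_+_ to _+ℕ_; _*_ to _*ℕ_; _∸_ to _∸ℕ_)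
open import Data.Nat.Combinatorics using (_C_)
open import Data.Integer using (+_)
open import Data.Rational using (ℚ; _/_; 0ℚ; 1ℚ; _+_; _*_)
open import Data.List using (List; []; _∷_; map; upTo)

↑ : ℕ → ℚ
↑ n = (+ n) / 1

-- total division of naturals into ℚ; the second clause is never used below
-- with a zero denominator in a relevant case
_÷_ : ℕ → ℕ → ℚ
a ÷ zero = 0ℚ
a ÷ suc d = (+ a) / suc d

sumℚ : List ℚ → ℚ
sumℚ [] = 0ℚ
sumℚ (x ∷ xs) = x + sumℚ xs

Σ[1…_]_ : ℕ → (ℕ → ℚ) → ℚ
Σ[1… m ] f = sumℚ (map (λ i → f (suc i)) (upTo m))

-- Fuelled version of the recurrence: each recursive call decreases m + n
-- by at least one, so fuel m + n + 1 suffices.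
Ef : ℕ → ℕ → ℕ → ℚ
Ef zero m n = 0ℚ
Ef (suc t) zero n = 0ℚ
Ef (suc t) (suc m') zero = 0ℚ
Ef (suc t) (suc m') (suc n') =
  1ℚ
  + (Σ[1… m ] λ k → ((m C k) *ℕ n) ÷ (((m +ℕ n) C k) *ℕ (m +ℕ n ∸ℕ k)) * Ef t (m ∸ℕ k) n)
  + (Σ[1… n ] λ k → ((n C k) *ℕ m) ÷ (((m +ℕ n) C k) *ℕ (m +ℕ n ∸ℕ k)) * Ef t m (n ∸ℕ k))
  where
  m = suc m'
  n = suc n'

E : ℕ → ℕ → ℚ
E m n = Ef (suc (m +ℕ n)) m n

-- Multiplied by binomials, the recurrence becomes a first-order linear PDE for the
-- generating function of E(m,n) C(m+n,m) / (m+n), which the substitution t = x(1-x),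
-- s = y(1-y) solves in closed form.  Its coefficients show that W = E + 1/2 satisfies
--   (m+n-1) W(m,n) = 2m W(m-1,n) - 1/C(m+n,m) - mn (H_{m-1} - H_{n-1})
-- for m ≥ 2, n ≥ 1, with H the harmonic numbers, and the mirror image in n.  Conversely,
-- take W to be the solution of this recurrence.  The first sum S in the recurrence for E then has the value
--   (m+n) S = n W(m,n) + ((m-n) / C(m+n,m) - 3m) / 2 + mn (H_{m-1} - H_{n-1}),
-- the second one mirrors it, and 1 plus both sums is W - 1/2.  The inhomogeneous terms span a
-- finite-dimensional space under m ↦ m+1, so a third-order operator with polynomial
-- coefficients ν₀, …, ν₃ annihilates them; applied to the first-order recurrence it gives
-- the fourth-order one.
module Submission where

open import Defs
open import Data.Nat using (ℕ; zero; suc; _≥_; _<_; z≤n; s≤s) renaming (_+_ to _+ℕ_; _*_ to _*ℕ_; _∸_ to _∸ℕ_)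
import Data.Nat.Properties as ℕ
open import Data.Nat.Combinatorics using (_C_; nC1≡n; nCn≡1; nCk≡nC[n∸k]; nCk+nC[k+1]≡[n+1]C[k+1]; k>n⇒nCk≡0)
open import Data.Integer.Base as ℤ using (ℤ; +_)
import Data.Integer.Properties as ℤ
open import Data.Rational using (ℚ; 0ℚ; ½; _+_; _*_; -_; _-_; _/_; toℚᵘ)
import Data.Rational.Properties as ℚ
open import Data.Rational.Unnormalised.Base as ℚᵘ using (mkℚᵘ; *≡*)
import Data.Rational.Unnormalised.Properties as ℚᵘ
open import Data.List using ([]; _∷_; map; upTo)
open import Data.List.Properties using (map-cong; map-upTo; map-applyUpTo)
import Data.Maybe.Base as Maybe
open import Function.Base using (_∘_; case_of_)
open import Relation.Nullary.Decidable using (dec⇒maybe)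
open import Relation.Binary.PropositionalEquality using (_≡_; refl; sym; trans; cong; cong₂; module ≡-Reasoning)
open import Algebra.Solver.Ring.AlmostCommutativeRing using (fromCommutativeRing; _-Raw-AlmostCommutative⟶_)

-- A ring solver for ℚ with integer coefficients.

ι : ℤ → ℚ
ι i = i / 1

toℚᵘ-ι : ∀ i → toℚᵘ (ι i) ℚᵘ.≃ mkℚᵘ i 0
toℚᵘ-ι i = ℚ.toℚᵘ-fromℚᵘ (mkℚᵘ i 0)

ι-+ : ∀ i j → ι (i ℤ.+ j) ≡ ι i + ι j
ι-+ i j = ℚ.toℚᵘ-injective (begin
  toℚᵘ (ι (i ℤ.+ j))           ≈⟨ toℚᵘ-ι (i ℤ.+ j) ⟩
  mkℚᵘ (i ℤ.+ j) 0             ≈⟨ *≡* (cong (ℤ._* (+ 1)) (sym (cong₂ ℤ._+_ (ℤ.*-identityʳ i) (ℤ.*-identityʳ j)))) ⟩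
  mkℚᵘ i 0 ℚᵘ.+ mkℚᵘ j 0       ≈⟨ ℚᵘ.+-cong (toℚᵘ-ι i) (toℚᵘ-ι j) ⟨
  toℚᵘ (ι i) ℚᵘ.+ toℚᵘ (ι j)   ≈⟨ ℚ.toℚᵘ-homo-+ (ι i) (ι j) ⟨
  toℚᵘ (ι i + ι j)             ∎)
  where open ℚᵘ.≃-Reasoning

ι-* : ∀ i j → ι (i ℤ.* j) ≡ ι i * ι j
ι-* i j = ℚ.toℚᵘ-injective (begin
  toℚᵘ (ι (i ℤ.* j))           ≈⟨ toℚᵘ-ι (i ℤ.* j) ⟩
  mkℚᵘ i 0 ℚᵘ.* mkℚᵘ j 0       ≈⟨ ℚᵘ.*-cong (toℚᵘ-ι i) (toℚᵘ-ι j) ⟨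
  toℚᵘ (ι i) ℚᵘ.* toℚᵘ (ι j)   ≈⟨ ℚ.toℚᵘ-homo-* (ι i) (ι j) ⟨
  toℚᵘ (ι i * ι j)             ∎)
  where open ℚᵘ.≃-Reasoning

ι-neg : ∀ i → ι (ℤ.- i) ≡ - ι i
ι-neg i = ℚ.toℚᵘ-injective (begin
  toℚᵘ (ι (ℤ.- i))   ≈⟨ toℚᵘ-ι (ℤ.- i) ⟩
  ℚᵘ.- mkℚᵘ i 0      ≈⟨ ℚᵘ.-‿cong (toℚᵘ-ι i) ⟨
  ℚᵘ.- toℚᵘ (ι i)    ≈⟨ ℚ.toℚᵘ-homo‿- (ι i) ⟨
  toℚᵘ (- ι i)       ∎)
  where open ℚᵘ.≃-Reasoning

ι-morphism : ℤ.+-*-rawRing -Raw-AlmostCommutative⟶ fromCommutativeRing ℚ.+-*-commutativeRing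
ι-morphism = record
  { ⟦_⟧ = ι ; +-homo = ι-+ ; *-homo = ι-* ; -‿homo = ι-neg ; 0-homo = refl ; 1-homo = refl }

open import Algebra.Solver.Ring ℤ.+-*-rawRing (fromCommutativeRing ℚ.+-*-commutativeRing) ι-morphism
  (λ i j → Maybe.map (cong ι) (dec⇒maybe (i ℤ.≟ j)))

K : ∀ {n} → ℕ → Polynomial n
K k = con (+ k)

-- Chained, this proves x ≡ y from hypotheses lᵢ ≡ rᵢ and a ring identity x - Σ (lᵢ - rᵢ) νᵢ ≡ y.
modulo : ∀ {x y ν l r} → l ≡ r → x - (l - r) * ν ≡ y → x ≡ y
modulo {x} {ν = ν} {l} refl eq = trans (solve 3 (λ x ν l → x := x :- (l :- l) :* ν) refl x ν l) eq

-- Casts of naturals and reciprocals.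

↑-+ : ∀ m n → ↑ (m +ℕ n) ≡ ↑ m + ↑ n
↑-+ m n = ι-+ (+ m) (+ n)

↑-* : ∀ m n → ↑ (m *ℕ n) ≡ ↑ m * ↑ n
↑-* m n = trans (cong ι (ℤ.pos-* m n)) (ι-* (+ m) (+ n))

↑-suc : ∀ m → ↑ (suc m) ≡ ↑ m + ↑ 1
↑-suc m = trans (cong ↑ (ℕ.+-comm 1 m)) (↑-+ m 1)

-- Opaque so that it stays a symbol for the ring solver, whose coefficients are integers.
opaque
  half : ℚ
  half = ½

  half+half : half + half ≡ ↑ 1
  half+half = refl

*-÷ : ∀ p k → ↑ (suc k) * (p ÷ suc k) ≡ ↑ p
*-÷ p k = ℚ.toℚᵘ-injective (begin
  toℚᵘ (↑ (suc k) * (p ÷ suc k))           ≈⟨ ℚ.toℚᵘ-homo-* (↑ (suc k)) (p ÷ suc k) ⟩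
  toℚᵘ (↑ (suc k)) ℚᵘ.* toℚᵘ (p ÷ suc k)   ≈⟨ ℚᵘ.*-cong (toℚᵘ-ι (+ suc k)) (ℚ.toℚᵘ-fromℚᵘ (mkℚᵘ (+ p) k)) ⟩
  mkℚᵘ (+ suc k) 0 ℚᵘ.* mkℚᵘ (+ p) k       ≈⟨ *≡* numerators ⟩
  mkℚᵘ (+ p) 0                             ≈⟨ toℚᵘ-ι (+ p) ⟨
  toℚᵘ (↑ p)                               ∎)
  where
  open ℚᵘ.≃-Reasoning
  numerators : + suc k ℤ.* + p ℤ.* + 1 ≡ + p ℤ.* + suc (k +ℕ 0)
  numerators = trans (ℤ.*-identityʳ (+ suc k ℤ.* + p))
    (trans (ℤ.*-comm (+ suc k) (+ p)) (cong (λ j → + p ℤ.* + suc j) (sym (ℕ.+-identityʳ k))))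

1/_ : ℕ → ℚ
1/ k = 1 ÷ k

-- Identities are proved after multiplication by a positive factor, and this removes it. The factor
-- enters through an equation, so it may be a sum of casts that the solver can expand.
cancel : ∀ k {x p q} → x ≡ ↑ (suc k) → x * p ≡ x * q → p ≡ q
cancel k {p = p} {q} refl eq =
  modulo (*-÷ 1 k) (modulo eq
  (solve 4 (λ x r p q → p :- (x :* r :- K 1) :* (:- (p :- q)) :- (x :* p :- x :* q) :* r := q)
    refl (↑ (suc k)) (1/ suc k) p q))

*-1/ : ∀ k {x} p → x ≡ ↑ (suc k) → x * (p * 1/ suc k) ≡ p
*-1/ k p refl =
  modulo (*-÷ 1 k)
  (solve 3 (λ x r p → x :* (p :* r) :- (x :* r :- K 1) :* p := p) refl (↑ (suc k)) (1/ suc k) p)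

÷≡*1/ : ∀ p q → p ÷ q ≡ ↑ p * 1/ q
÷≡*1/ p zero    = sym (ℚ.*-zeroʳ (↑ p))
÷≡*1/ p (suc k) = cancel k refl (trans (*-÷ p k) (sym (*-1/ k (↑ p) refl)))

-- Unconditional because the reciprocal of 0 is 0 here; `weight-suc` relies on this for `k` beyond
-- `m +ℕ n`, where the binomials vanish.
1/-* : ∀ p q → 1/ (p *ℕ q) ≡ 1/ p * 1/ q
1/-* zero    q       = sym (ℚ.*-zeroˡ (1/ q))
1/-* (suc p) zero    = trans (cong 1/_ (ℕ.*-zeroʳ p)) (sym (ℚ.*-zeroʳ (1/ suc p)))
1/-* (suc p) (suc q) = cancel (q +ℕ p *ℕ suc q) refl
  (modulo (*-÷ 1 (q +ℕ p *ℕ suc q)) (modulo (↑-* (suc p) (suc q)) (modulo (*-÷ 1 p) (modulo (*-÷ 1 q)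
  (solve 6 (λ x y z r s t →
      z :* t
      :- (z :* t :- K 1) :* K 1
      :- (z :- x :* y) :* (:- (r :* s))
      :- (x :* r :- K 1) :* (:- (y :* s))
      :- (y :* s :- K 1) :* (:- K 1)
      := z :* (r :* s))
    refl (↑ (suc p)) (↑ (suc q)) (↑ (suc p *ℕ suc q)) (1/ suc p) (1/ suc q) (1/ (suc p *ℕ suc q)))))))

-- Harmonic numbers, reciprocal binomials and the first-order recurrences in both directions.

H : ℕ → ℚ
H zero    = 0ℚ
H (suc k) = H k + 1/ suc k

H-suc : ∀ k {x} → x ≡ ↑ (suc k) → x * H (suc k) ≡ x * H k + ↑ 1
H-suc k refl = modulo (*-÷ 1 k)
  (solve 3 (λ x h r → x :* (h :+ r) :- (x :* r :- K 1) :* K 1 := x :* h :+ K 1)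
    refl (↑ (suc k)) (H k) (1/ suc k))

-- D a b = 1 / C(a+b+2, a+1) and W a b = E(a+1, b+1) + 1/2.
D : ℕ → ℕ → ℚ
D zero    b = 1/ (2 +ℕ b)
D (suc a) b = (↑ (suc a) + ↑ 1) * D a b * 1/ (3 +ℕ (a +ℕ b))

W : ℕ → ℕ → ℚ
-- A separate initial condition: extending the first-order law to m = 1 with W(0,n) = 1/2 would give
-- the constant 1 instead of 2.
W zero    b = (↑ 2 - D zero b + ↑ (suc b) * H b) * 1/ suc b
W (suc a) b =
  (↑ 2 * (↑ (suc a) + ↑ 1) * W a b - D (suc a) b - (↑ (suc a) + ↑ 1) * ↑ (suc b) * (H (suc a) - H b))
  * 1/ (2 +ℕ (a +ℕ b))

-- D and W are defined by recursion on a; the same laws also hold in b (column-right).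
record Column (b : ℕ) (v d : ℕ → ℚ) : Set where
  field
    d-zero : ∀ {y} → y ≡ ↑ (suc b) → (y + ↑ 1) * d 0 ≡ ↑ 1
    d-suc  : ∀ a {x y} → x ≡ ↑ (suc a) → y ≡ ↑ (suc b) →
             (x + y + ↑ 1) * d (suc a) ≡ (x + ↑ 1) * d a
    v-zero : ∀ {y} → y ≡ ↑ (suc b) → y * v 0 ≡ ↑ 2 - d 0 + y * H b
    v-suc  : ∀ a {x y} → x ≡ ↑ (suc a) → y ≡ ↑ (suc b) →
             (x + y) * v (suc a) ≡ ↑ 2 * (x + ↑ 1) * v a - d (suc a) - (x + ↑ 1) * y * (H (suc a) - H b)

open Column

↑-suc-suc : ∀ a b → ↑ (suc a) + ↑ (suc b) ≡ ↑ (2 +ℕ (a +ℕ b))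
↑-suc-suc a b = trans (sym (↑-+ (suc a) (suc b))) (cong (λ k → ↑ (suc k)) (ℕ.+-suc a b))

↑-suc-suc-1 : ∀ a b → ↑ (suc a) + ↑ (suc b) + ↑ 1 ≡ ↑ (3 +ℕ (a +ℕ b))
↑-suc-suc-1 a b = trans (cong (_+ ↑ 1) (↑-suc-suc a b)) (sym (↑-suc (2 +ℕ (a +ℕ b))))

column-left : ∀ b → Column b (λ a → W a b) (λ a → D a b)
column-left b = record
  { d-zero = λ { refl → trans (cong (_* D 0 b) (sym (↑-suc (suc b)))) (*-÷ 1 (suc b)) }
  ; d-suc  = λ { a refl refl → *-1/ (2 +ℕ (a +ℕ b)) ((↑ (suc a) + ↑ 1) * D a b) (↑-suc-suc-1 a b) }
  ; v-zero = λ { refl → *-1/ b (↑ 2 - D zero b + ↑ (suc b) * H b) refl }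
  ; v-suc  = λ { a refl refl → *-1/ (suc (a +ℕ b)) _ (↑-suc-suc a b) }
  }

-- Multiplied by a+b+3, both sides become (a+2)(b+2) `D a b`. The law in `b` is a hypothesis because
-- `column-right` applies this lemma to its induction hypothesis.
D-exchange : ∀ a b → Column a (W a) (D a) → (↑ (suc a) + ↑ 1) * D a (suc b) ≡ (↑ (suc b) + ↑ 1) * D (suc a) b
D-exchange a b col = cancel (2 +ℕ (b +ℕ a)) (↑-suc-suc-1 b a)
  (modulo (d-suc col b refl refl) (modulo (d-suc (column-left b) a refl refl)
  (solve 5 (λ x y d d₁ d₂ →
      (x :+ y :+ K 1) :* ((y :+ K 1) :* d₂)
      :- ((x :+ y :+ K 1) :* d₂ :- (x :+ K 1) :* d) :* (y :+ K 1)
      :- ((y :+ x :+ K 1) :* d₁ :- (y :+ K 1) :* d) :* (:- (x :+ K 1))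
      := (x :+ y :+ K 1) :* ((x :+ K 1) :* d₁))
    refl (↑ (suc b)) (↑ (suc a)) (D a b) (D (suc a) b) (D a (suc b)))))

-- Compatibility on the boundary: when the other color has one ball, the right side of `v-suc`
-- agrees with that of `v-zero`. Multiplying by `x` lets all three hypotheses be substituted, and
-- `d′` cancels.
first-row : ∀ k {x v d d′ h h′} → x ≡ ↑ (suc k) →
  (x + ↑ 1) * d ≡ ↑ 1 → x * v ≡ ↑ 2 - d + x * h → x * h′ ≡ x * h + ↑ 1 →
  ↑ 2 * (x + ↑ 1) * v - d′ - (x + ↑ 1) * ↑ 1 * (h′ - 0ℚ) ≡ ↑ 2 - d′ + (x + ↑ 1) * h′
first-row k {x} {v} {d} {d′} {h} {h′} x≡ d-eq v-eq h-eq = cancel k x≡ (modulo d-eq (modulo v-eq (modulo h-eq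
  (solve 6 (λ x v d d′ h h′ →
      x :* (K 2 :* (x :+ K 1) :* v :- d′ :- (x :+ K 1) :* K 1 :* (h′ :- K 0))
      :- ((x :+ K 1) :* d :- K 1) :* (:- K 2)
      :- (x :* v :- (K 2 :- d :+ x :* h)) :* (K 2 :* (x :+ K 1))
      :- (x :* h′ :- (x :* h :+ K 1)) :* (:- (K 2 :* (x :+ K 1)))
      := x :* (K 2 :- d′ :+ (x :+ K 1) :* h′))
    refl x v d d′ h h′))))

column-right : ∀ a → Column a (W a) (D a)
column-right zero = record
  { d-zero = d-zero (column-left 0)
  ; d-suc  = λ { b refl refl → trans (d-zero (column-left (suc b)) (sym (↑-suc (suc b))))
                                     (sym (d-zero (column-left b) refl)) }
  ; v-zero = v-zero (column-left 0)
  ; v-suc  = λ { b refl refl → trans (v-zero (column-left (suc b)) (sym (↑-suc (suc b))))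
      (sym (first-row b refl (d-zero (column-left b) refl) (v-zero (column-left b) refl) (H-suc b refl))) }
  }
column-right (suc a) = record
  -- Matching on the composed equation turns the cast of a+2 into `↑ (suc a) + ↑ 1`, which the
  -- solver can relate to the cast of a+1.
  { d-zero = λ y≡ → case trans y≡ (↑-suc (suc a)) of λ { refl →
      trans (d-suc (column-left 0) a refl refl) (d-zero IH refl) }
  ; d-suc  = λ { b {x} refl y≡ → case trans y≡ (↑-suc (suc a)) of λ { refl →
      modulo (d-suc (column-left (suc b)) a refl (sym (↑-suc (suc b)))) (modulo (D-exchange a b IH)
        (solve 5 (λ x y d₁ d₂ d₁₂ →
            (x :+ (y :+ K 1) :+ K 1) :* d₁₂
            :- ((y :+ (x :+ K 1) :+ K 1) :* d₁₂ :- (y :+ K 1) :* d₂) :* K 1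
            :- ((y :+ K 1) :* d₂ :- (x :+ K 1) :* d₁) :* K 1
            := (x :+ K 1) :* d₁)
          refl (↑ (suc b)) (↑ (suc a)) (D (suc a) b) (D a (suc b)) (D (suc a) (suc b)))) } }
  ; v-zero = λ y≡ → case trans y≡ (↑-suc (suc a)) of λ { refl →
      trans (v-suc (column-left 0) a refl refl)
            (first-row a refl (d-zero IH refl) (v-zero IH refl) (H-suc a refl)) }
  -- Path independence around a unit square: `W (suc a) (suc b)` and `W (suc a) b` are both traced
  -- back to `W a b`, the former through `W a (suc b)`. The leftover terms in `D` and `H` vanish by
  -- `D-exchange` and `H-suc`.
  ; v-suc  = λ { b {x} refl y≡ → case trans y≡ (↑-suc (suc a)) of λ { refl →
      cancel (suc (b +ℕ a)) (↑-suc-suc b a)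
        (modulo (v-suc (column-left (suc b)) a refl (sym (↑-suc (suc b))))
        (modulo (v-suc IH b refl refl)
        (modulo (v-suc (column-left b) a refl refl)
        (modulo (D-exchange a b IH)
        (modulo (H-suc a refl)
        (modulo (H-suc b refl)
        (solve 13 (λ x y v v₁ v₂ v₁₂ d₁ d₂ d₁₂ hx hx′ hy hy′ →
            (x :+ y) :* ((x :+ (y :+ K 1)) :* v₁₂)
            :- ((y :+ (x :+ K 1)) :* v₁₂ :- (K 2 :* (y :+ K 1) :* v₂ :- d₁₂ :- (y :+ K 1) :* (x :+ K 1) :* (hy′ :- hx′)))
               :* (x :+ y)
            :- ((x :+ y) :* v₂ :- (K 2 :* (x :+ K 1) :* v :- d₂ :- (x :+ K 1) :* y :* (hx′ :- hy)))
               :* (K 2 :* (y :+ K 1))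
            :- ((y :+ x) :* v₁ :- (K 2 :* (y :+ K 1) :* v :- d₁ :- (y :+ K 1) :* x :* (hy′ :- hx)))
               :* (:- (K 2 :* (x :+ K 1)))
            :- ((y :+ K 1) :* d₂ :- (x :+ K 1) :* d₁) :* (:- K 2)
            :- (y :* hy′ :- (y :* hy :+ K 1)) :* (:- (K 2 :* (x :+ K 1) :* (y :+ K 1)))
            :- (x :* hx′ :- (x :* hx :+ K 1)) :* (K 2 :* (x :+ K 1) :* (y :+ K 1))
            := (x :+ y) :* (K 2 :* (x :+ K 1) :* v₁ :- d₁₂ :- (x :+ K 1) :* (y :+ K 1) :* (hx′ :- hy′)))
          refl (↑ (suc b)) (↑ (suc a)) (W a b) (W (suc a) b) (W a (suc b)) (W (suc a) (suc b))
          (D (suc a) b) (D a (suc b)) (D (suc a) (suc b)) (H b) (H (suc b)) (H a) (H (suc a))))))))) } }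
  }
  where IH = column-right a

-- Draw weights and their sums.

nC0≡1 : ∀ n → n C 0 ≡ 1
nC0≡1 n = trans (nCk≡nC[n∸k] {0} {n} z≤n) (nCn≡1 n)

absorption : ∀ n k → suc k *ℕ (suc n C suc k) ≡ suc n *ℕ (n C k)
absorption n       zero    = trans (ℕ.*-identityˡ (suc n C 1)) (trans (nC1≡n (suc n))
  (sym (trans (cong (suc n *ℕ_) (nC0≡1 n)) (ℕ.*-identityʳ (suc n)))))
absorption zero    (suc k) = trans
  (cong (suc (suc k) *ℕ_) (k>n⇒nCk≡0 {1} {suc (suc k)} (s≤s (s≤s z≤n))))
  (ℕ.*-zeroʳ (suc (suc k)))
absorption (suc n) (suc k) = begin
  suc (suc k) *ℕ (suc (suc n) C suc (suc k))      ≡⟨ cong (suc (suc k) *ℕ_) (nCk+nC[k+1]≡[n+1]C[k+1] (suc n) (suc k)) ⟨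
  suc (suc k) *ℕ (X +ℕ (suc n C suc (suc k)))     ≡⟨ ℕ.*-distribˡ-+ (suc (suc k)) X _ ⟩
  suc (suc k) *ℕ X +ℕ suc (suc k) *ℕ (suc n C suc (suc k))
                                                  -- The first product unfolds by computation to
                                                  -- `X +ℕ suc k *ℕ X`, which exposes the instance
                                                  -- at `n` and `k`.
                                                  ≡⟨ cong₂ (λ p q → X +ℕ p +ℕ q) (absorption n k) (absorption n (suc k)) ⟩
  X +ℕ suc n *ℕ (n C k) +ℕ suc n *ℕ (n C suc k)   ≡⟨ ℕ.+-assoc X (suc n *ℕ (n C k)) (suc n *ℕ (n C suc k)) ⟩
  X +ℕ (suc n *ℕ (n C k) +ℕ suc n *ℕ (n C suc k)) ≡⟨ cong (X +ℕ_) (ℕ.*-distribˡ-+ (suc n) (n C k) (n C suc k)) ⟨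
  X +ℕ suc n *ℕ ((n C k) +ℕ (n C suc k))          ≡⟨ cong (λ p → X +ℕ suc n *ℕ p) (nCk+nC[k+1]≡[n+1]C[k+1] n k) ⟩
  suc (suc n) *ℕ X                                ∎
  where
  open ≡-Reasoning
  X = suc n C suc k

-- The red draws use the same weights with m and n exchanged, so one lemma covers both sums.
weight : ℕ → ℕ → ℕ → ℚ
weight m n k = ((m C k) *ℕ n) ÷ (((m +ℕ n) C k) *ℕ (m +ℕ n ∸ℕ k))

part : (ℕ → ℚ) → ℕ → ℕ → ℚ
part F m n = Σ[1… m ] λ k → weight m n k * F (m ∸ℕ k)

-- The sums start at k = 1; index 0 arises when the sum for m+1 is shifted onto the one for m.
weight-zero : ∀ m n → (↑ m + ↑ (suc n)) * weight m (suc n) 0 ≡ ↑ (suc n)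
weight-zero m n
  rewrite nC0≡1 m | nC0≡1 (m +ℕ suc n) | ℕ.*-identityˡ (suc n)
        | ℕ.*-identityˡ (m +ℕ suc n) | sym (↑-+ m (suc n)) | ℕ.+-suc m n
  = *-÷ (suc n) (m +ℕ n)

weight-product : ∀ m n k → weight m n k ≡ ↑ (m C k) * ↑ n * (1/ ((m +ℕ n) C k) * 1/ (m +ℕ n ∸ℕ k))
weight-product m n k = trans (÷≡*1/ ((m C k) *ℕ n) (((m +ℕ n) C k) *ℕ (m +ℕ n ∸ℕ k)))
   (cong₂ _*_ (↑-* (m C k) n) (1/-* ((m +ℕ n) C k) (m +ℕ n ∸ℕ k)))

-- Absorption in both binomials: the factors k+1 cancel, and m+n-k, the number of balls left, is the
-- same on both sides.
weight-suc : ∀ m n k → ↑ (suc (m +ℕ n)) * weight (suc m) n (suc k) ≡ ↑ (suc m) * weight m n k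
weight-suc m n k =
  modulo (weight-product (suc m) n (suc k)) (modulo (weight-product m n k)
  (modulo (*-÷ 1 k) (modulo (*-÷ 1 (m +ℕ n)) (modulo top (modulo bottom
  (solve 13 (λ w w′ s x j q r n z p p′ y y′ →
      s :* w′
      :- (w′ :- p′ :* n :* (y′ :* z)) :* s
      :- (w :- p :* n :* (y :* z)) :* (:- x)
      :- (j :* q :- K 1) :* (:- (s :* p′ :* y′ :* n :* z))
      :- (s :* r :- K 1) :* (j :* p′ :* y :* n :* z)
      :- (j :* p′ :- x :* p) :* (y :* n :* z)
      :- (q :* y′ :- r :* y) :* (s :* j :* p′ :* n :* z)
      := x :* w)
    refl (weight m n k) (weight (suc m) n (suc k)) (↑ (suc (m +ℕ n))) (↑ (suc m)) (↑ (suc k))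
    (1/ suc k) (1/ suc (m +ℕ n)) (↑ n) (1/ (m +ℕ n ∸ℕ k)) (↑ (m C k)) (↑ (suc m C suc k)) (1/ ((m +ℕ n) C k)) (1/ (suc (m +ℕ n) C suc k))))))))
  where
  top : ↑ (suc k) * ↑ (suc m C suc k) ≡ ↑ (suc m) * ↑ (m C k)
  top = trans (sym (↑-* (suc k) (suc m C suc k))) (trans (cong ↑ (absorption m k)) (↑-* (suc m) (m C k)))
  bottom : 1/ suc k * 1/ (suc (m +ℕ n) C suc k) ≡ 1/ suc (m +ℕ n) * 1/ ((m +ℕ n) C k)
  bottom = trans (sym (1/-* (suc k) (suc (m +ℕ n) C suc k)))
    (trans (cong 1/_ (absorption (m +ℕ n) k)) (1/-* (suc (m +ℕ n)) ((m +ℕ n) C k)))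

sum-upTo-suc : ∀ (f : ℕ → ℚ) m → sumℚ (map f (upTo (suc m))) ≡ f 0 + sumℚ (map (f ∘ suc) (upTo m))
sum-upTo-suc f m = cong (λ xs → f 0 + sumℚ xs) (trans (map-applyUpTo suc f m) (sym (map-upTo (f ∘ suc) m)))

sum-scale : ∀ p q (f g : ℕ → ℚ) → (∀ i → p * f i ≡ q * g i) →
  ∀ xs → p * sumℚ (map f xs) ≡ q * sumℚ (map g xs)
sum-scale p q f g eq []       = trans (ℚ.*-zeroʳ p) (sym (ℚ.*-zeroʳ q))
sum-scale p q f g eq (x ∷ xs) =
  trans (ℚ.*-distribˡ-+ p (f x) _)
  (trans (cong₂ _+_ (eq x) (sum-scale p q f g eq xs)) (sym (ℚ.*-distribˡ-+ q (g x) _)))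

-- Raising m and k together keeps the argument m-k of `F` and scales every weight by the same ratio,
-- (m+1)/(t+1). So the new sum is the old one, extended by its term at k = 0 and rescaled.
part-suc : ∀ F m n → let t = ↑ m + ↑ (suc n) in
  (t + ↑ 1) * (t * part F (suc m) (suc n)) ≡ (↑ m + ↑ 1) * (↑ (suc n) * F m + t * part F m (suc n))
part-suc F m n =
  modulo
    (sum-scale (t + ↑ 1) (↑ m + ↑ 1)
      (λ i → weight (suc m) (suc n) (suc i) * F (m ∸ℕ i)) f scaled (upTo (suc m)))
  (modulo (sum-upTo-suc f m) (modulo (weight-zero m n)
  (solve 7 (λ x y f w p p′ s →
      (x :+ y :+ K 1) :* ((x :+ y) :* p′)
      :- ((x :+ y :+ K 1) :* p′ :- (x :+ K 1) :* s) :* (x :+ y)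
      :- (s :- (w :* f :+ p)) :* ((x :+ K 1) :* (x :+ y))
      :- ((x :+ y) :* w :- y) :* ((x :+ K 1) :* f)
      := (x :+ K 1) :* (y :* f :+ (x :+ y) :* p))
    refl (↑ m) (↑ (suc n)) (F m) (weight m (suc n) 0) (part F m (suc n)) (part F (suc m) (suc n))
    (sumℚ (map f (upTo (suc m)))))))
  where
  t = ↑ m + ↑ (suc n)

  f : ℕ → ℚ
  f i = weight m (suc n) i * F (m ∸ℕ i)

  t+1≡ : t + ↑ 1 ≡ ↑ (suc (m +ℕ suc n))
  t+1≡ = trans (cong (_+ ↑ 1) (sym (↑-+ m (suc n)))) (sym (↑-suc (m +ℕ suc n)))

  scaled : ∀ i → (t + ↑ 1) * (weight (suc m) (suc n) (suc i) * F (m ∸ℕ i)) ≡ (↑ m + ↑ 1) * f i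
  scaled i = modulo t+1≡ (modulo (↑-suc m) (modulo (weight-suc m (suc n) i)
    (solve 7 (λ t x x′ s w w′ f →
        (t :+ K 1) :* (w′ :* f)
        :- (t :+ K 1 :- s) :* (w′ :* f)
        :- (x′ :- (x :+ K 1)) :* (w :* f)
        :- (s :* w′ :- x′ :* w) :* f
        := (x :+ K 1) :* (w :* f))
      refl t (↑ m) (↑ (suc m)) (↑ (suc (m +ℕ suc n)))
      (weight m (suc n) i) (weight (suc m) (suc n) (suc i)) (F (m ∸ℕ i)))))

-- By induction on `a`, the right side obeys the recurrence of `part-suc`. An abstract `Column` is
-- used so that `column-left` and `column-right` evaluate the green and the red sum.
part-closed : ∀ {b v d} → Column b v d → ∀ F → F 0 ≡ 0ℚ → (∀ a → F (suc a) ≡ v a - half) →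
  ∀ a {x y} → x ≡ ↑ (suc a) → y ≡ ↑ (suc b) →
  (x + y) * part F (suc a) (suc b) ≡ y * v a + half * ((x - y) * d a - ↑ 3 * x) + x * y * (H a - H b)
part-closed {b} {v} {d} col F F0 Fs zero refl refl = cancel b refl
  (modulo (part-suc F 0 b) (modulo F0 (modulo (v-zero col refl) (modulo (d-zero col refl) (modulo half+half
  (solve 7 (λ y f p v d h c →
      y :* ((K 1 :+ y) :* p)
      :- ((K 0 :+ y :+ K 1) :* ((K 0 :+ y) :* p) :- (K 0 :+ K 1) :* (y :* f :+ (K 0 :+ y) :* K 0)) :* K 1
      :- (f :- K 0) :* y
      :- (y :* v :- (K 2 :- d :+ y :* c)) :* (:- y)
      :- ((y :+ K 1) :* d :- K 1) :* (h :* y)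
      :- (h :+ h :- K 1) :* (K 2 :* y :- y :* d)
      := y :* (y :* v :+ h :* ((K 1 :- y) :* d :- K 3 :* K 1) :+ K 1 :* y :* (K 0 :- c)))
    refl (↑ (suc b)) (F 0) (part F 1 (suc b)) (v 0) (d 0) half (H b)))))))
part-closed {b} {v} {d} col F F0 Fs (suc a) x≡ refl = case trans x≡ (↑-suc (suc a)) of λ { refl →
  cancel (suc (a +ℕ b)) (↑-suc-suc a b)
  (modulo (part-suc F (suc a) b) (modulo (Fs a) (modulo (part-closed col F F0 Fs a refl refl)
  (modulo (v-suc col a refl refl) (modulo (d-suc col a refl refl) (modulo (H-suc a refl) (modulo half+half
  (solve 13 (λ x y f p p′ v v′ d d′ g g′ c h →
      (x :+ y) :* ((x :+ K 1 :+ y) :* p′)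
      :- ((x :+ y :+ K 1) :* ((x :+ y) :* p′) :- (x :+ K 1) :* (y :* f :+ (x :+ y) :* p)) :* K 1
      :- (f :- (v :- h)) :* ((x :+ K 1) :* y)
      :- ((x :+ y) :* p :- (y :* v :+ h :* ((x :- y) :* d :- K 3 :* x) :+ x :* y :* (g :- c))) :* (x :+ K 1)
      :- ((x :+ y) :* v′ :- (K 2 :* (x :+ K 1) :* v :- d′ :- (x :+ K 1) :* y :* (g′ :- c))) :* (:- y)
      :- ((x :+ y :+ K 1) :* d′ :- (x :+ K 1) :* d) :* (:- (h :* (x :- y)))
      :- (x :* g′ :- (x :* g :+ K 1)) :* (:- ((x :+ K 1) :* y))
      :- (h :+ h :- K 1) :* (y :* (x :+ K 1) :- y :* d′)
      := (x :+ y) :* (y :* v′ :+ h :* ((x :+ K 1 :- y) :* d′ :- K 3 :* (x :+ K 1)) :+ (x :+ K 1) :* y :* (g′ :- c)))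
    refl (↑ (suc a)) (↑ (suc b)) (F (suc a)) (part F (suc a) (suc b)) (part F (suc (suc a)) (suc b))
    (v a) (v (suc a)) (d a) (d (suc a)) (H a) (H (suc a)) (H b) half)))))))) }

-- Identification of `E` with the first-order solution.

closed : ℕ → ℕ → ℚ
closed zero    n       = 0ℚ
closed (suc a) zero    = 0ℚ
closed (suc a) (suc b) = W a b - half

-- Since k starts at 1, only arguments below `m` occur; this makes the induction on fuel in
-- `Ef-closed` go through.
part-cong : ∀ {F G : ℕ → ℚ} m n → (∀ j → j < m → F j ≡ G j) → part F m n ≡ part G m n
part-cong zero    n eq = refl
part-cong {F} {G} (suc m) n eq = cong sumℚ
  (map-cong (λ i → cong (weight (suc m) n (suc i) *_) (eq (m ∸ℕ i) (s≤s (ℕ.m∸n≤m m i)))) (upTo (suc m)))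

-- In the total of the two sums, the terms in `D` and `H` are antisymmetric under exchange of colors
-- and cancel. What remains is 1 + W - 3/2 = W - 1/2.
Ef-closed : ∀ t m n → m +ℕ n < t → Ef t m n ≡ closed m n
Ef-closed (suc t) zero    n       m+n<t = refl
Ef-closed (suc t) (suc a) zero    m+n<t = refl
Ef-closed (suc t) m@(suc a) n@(suc b) (s≤s m+n≤t) = cancel (suc (a +ℕ b)) (↑-suc-suc a b)
  (modulo green (modulo red
  (modulo (part-closed (column-left b) (λ j → closed j n) refl (λ _ → refl) a refl refl)
  (modulo (part-closed (column-right a) (λ j → closed m j) refl (λ _ → refl) b refl refl)
  (modulo half+half
  (solve 11 (λ x y p p′ q q′ w d g c h →
      (x :+ y) :* (K 1 :+ p :+ q)
      :- (p :- p′) :* (x :+ y)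
      :- (q :- q′) :* (x :+ y)
      :- ((x :+ y) :* p′ :- (y :* w :+ h :* ((x :- y) :* d :- K 3 :* x) :+ x :* y :* (g :- c))) :* K 1
      :- ((y :+ x) :* q′ :- (x :* w :+ h :* ((y :- x) :* d :- K 3 :* y) :+ y :* x :* (c :- g))) :* K 1
      :- (h :+ h :- K 1) :* (:- (x :+ y))
      := (x :+ y) :* (w :- h))
    refl (↑ m) (↑ n) (part (λ j → Ef t j n) m n) (part (λ j → closed j n) m n)
    (Σ[1… n ] λ k → ((n C k) *ℕ m) ÷ (((m +ℕ n) C k) *ℕ (m +ℕ n ∸ℕ k)) * Ef t m (n ∸ℕ k))
    (part (λ j → closed m j) n m)
    (W a b) (D a b) (H a) (H b) half))))))
  where
  green : part (λ j → Ef t j n) m n ≡ part (λ j → closed j n) m n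
  green = part-cong m n (λ j j<m → Ef-closed t j n (ℕ.<-≤-trans (ℕ.+-monoˡ-< n j<m) m+n≤t))
  red : (Σ[1… n ] λ k → ((n C k) *ℕ m) ÷ (((m +ℕ n) C k) *ℕ (m +ℕ n ∸ℕ k)) * Ef t m (n ∸ℕ k))
      ≡ part (λ j → closed m j) n m
  red = trans
    (cong (λ s → Σ[1… n ] λ k → ((n C k) *ℕ m) ÷ ((s C k) *ℕ (s ∸ℕ k)) * Ef t m (n ∸ℕ k)) (ℕ.+-comm m n))
    (part-cong n m (λ j j<n → Ef-closed t m j (ℕ.<-≤-trans (ℕ.+-monoʳ-< m j<n) m+n≤t)))

E-closed : ∀ m n → E m n ≡ closed m n
E-closed m n = Ef-closed (suc (m +ℕ n)) m n (ℕ.n<1+n (m +ℕ n))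

-- From the first-order to the fourth-order recurrence.

-- Passing from W to W - 1/2 in `v-suc` leaves half of 2(x+1) - (x+y), the new inhomogeneous term.
closed-suc : ∀ a b {x y e e′} → x ≡ ↑ (suc a) → y ≡ ↑ (suc b) →
  e ≡ closed (suc a) (suc b) → e′ ≡ closed (suc (suc a)) (suc b) →
  (x + y) * e′ ≡ ↑ 2 * (x + ↑ 1) * e + half * (x + ↑ 2 - y) - D (suc a) b - (x + ↑ 1) * y * (H (suc a) - H b)
closed-suc a b refl refl refl refl = modulo (v-suc (column-left b) a refl refl)
  (solve 8 (λ x y w w′ d g c h →
      (x :+ y) :* (w′ :- h)
      :- ((x :+ y) :* w′ :- (K 2 :* (x :+ K 1) :* w :- d :- (x :+ K 1) :* y :* (g :- c))) :* K 1
      := K 2 :* (x :+ K 1) :* (w :- h) :+ h :* (x :+ K 2 :- y) :- d :- (x :+ K 1) :* y :* (g :- c))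
    refl (↑ (suc a)) (↑ (suc b)) (W a b) (W (suc a) b) (D (suc a) b) (H (suc a)) (H b) half)

theorem1 : (m n : ℕ) → m ≥ 1 → n ≥ 1 →
  ↑ 2 * (↑ m + ↑ 2) * (↑ m + ↑ 1) * (↑ 2 * ↑ m * ↑ n + ↑ 2 * ↑ m + ↑ 7 * ↑ n + ↑ 9) * (↑ m + ↑ 3) * E m n
  + (- ((↑ m + ↑ 3) * (↑ m + ↑ 2) * (↑ 14 * ↑ m * ↑ m * ↑ n + ↑ 6 * ↑ m * ↑ n * ↑ n + ↑ 14 * ↑ m * ↑ m + ↑ 83 * ↑ m * ↑ n + ↑ 21 * ↑ n * ↑ n + ↑ 91 * ↑ m + ↑ 123 * ↑ n + ↑ 128) * E (m +ℕ 1) n))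
  + (↑ m + ↑ 3) * (↑ 18 * ↑ m * ↑ m * ↑ m * ↑ n + ↑ 16 * ↑ m * ↑ m * ↑ n * ↑ n + ↑ 2 * ↑ m * ↑ n * ↑ n * ↑ n + ↑ 18 * ↑ m * ↑ m * ↑ m + ↑ 167 * ↑ m * ↑ m * ↑ n + ↑ 94 * ↑ m * ↑ n * ↑ n + ↑ 7 * ↑ n * ↑ n * ↑ n + ↑ 169 * ↑ m * ↑ m + ↑ 521 * ↑ m * ↑ n + ↑ 132 * ↑ n * ↑ n + ↑ 511 * ↑ m + ↑ 537 * ↑ n + ↑ 508) * E (m +ℕ 2) n
  + (- (↑ 10 * ↑ m * ↑ m * ↑ m * ↑ m * ↑ n + ↑ 14 * ↑ m * ↑ m * ↑ m * ↑ n * ↑ n + ↑ 4 * ↑ m * ↑ m * ↑ n * ↑ n * ↑ n + ↑ 10 * ↑ m * ↑ m * ↑ m * ↑ m + ↑ 135 * ↑ m * ↑ m * ↑ m * ↑ n + ↑ 129 * ↑ m * ↑ m * ↑ n * ↑ n + ↑ 24 * ↑ m * ↑ n * ↑ n * ↑ n + ↑ 131 * ↑ m * ↑ m * ↑ m + ↑ 684 * ↑ m * ↑ m * ↑ n + ↑ 393 * ↑ m * ↑ n * ↑ n + ↑ 34 * ↑ n * ↑ n * ↑ n + ↑ 639 * ↑ m * ↑ m + ↑ 1535 * ↑ m * ↑ n + ↑ 396 * ↑ n * ↑ n + ↑ 1380 * ↑ m + ↑ 1286 * ↑ n + ↑ 1116) * E (m +ℕ 3) n)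
  + (↑ m + ↑ 3) * (↑ 2 * ↑ m * ↑ n + ↑ 2 * ↑ m + ↑ 5 * ↑ n + ↑ 7) * (↑ m + ↑ n + ↑ 4) * (↑ m + ↑ n + ↑ 3) * E (m +ℕ 4) n
  ≡ 0ℚ
theorem1 m@(suc a) n@(suc b) _ _ =
  modulo (step 0 E₀ E₁) (modulo (step 1 E₁ E₂) (modulo (step 2 E₂ E₃) (modulo (step 3 E₃ E₄)
  (modulo (d-step 1) (modulo (d-step 2) (modulo (d-step 3)
  (modulo (h-step 1) (modulo (h-step 2) (modulo (h-step 3) (modulo half+half
  (solve 17 (λ M N e0 e1 e2 e3 e4 d1 d2 d3 d4 g1 g2 g3 g4 c h →
    -- The νᵢ are the right quotient of the fourth-order operator by the first-order one, and
    -- Q is P at m-1; δ, η, θ eliminate D, H and half through their own recurrences.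
    let P  = K 2 :* M :* N :+ K 2 :* M :+ K 7 :* N :+ K 9
        Q  = P :- K 2 :* N :- K 2
        R  = N :- K 1 :- (K 2 :* M :+ K 5) :* P
        ν0 = :- ((M :+ K 2) :* (M :+ K 3) :* P)
        ν1 = (M :+ K 3) :* ((M :+ N :+ K 2) :* P :- R)
        ν2 = (M :+ N :+ K 3) :* R :- (M :+ K 3) :* (M :+ K 4) :* Q
        ν3 = (M :+ K 3) :* (M :+ N :+ K 4) :* Q
        δ1 = :- ((M :+ K 3) :* P)
        δ2 = :- R
        δ3 = :- ((M :+ K 3) :* Q)
        η1 = N :* ν0
        η2 = N :* (M :+ K 3) :* ((N :+ K 1) :* P :- R)
        η3 = :- (N :* (M :+ K 4) :* (M :+ N :+ K 4) :* Q)
        θ  = :- (η1 :+ η2 :+ η3)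
    in
      K 2 :* (M :+ K 2) :* (M :+ K 1) :* (K 2 :* M :* N :+ K 2 :* M :+ K 7 :* N :+ K 9) :* (M :+ K 3) :* e0
      :+ (:- ((M :+ K 3) :* (M :+ K 2) :* (K 14 :* M :* M :* N :+ K 6 :* M :* N :* N :+ K 14 :* M :* M :+ K 83 :* M :* N :+ K 21 :* N :* N :+ K 91 :* M :+ K 123 :* N :+ K 128) :* e1))
      :+ (M :+ K 3) :* (K 18 :* M :* M :* M :* N :+ K 16 :* M :* M :* N :* N :+ K 2 :* M :* N :* N :* N :+ K 18 :* M :* M :* M :+ K 167 :* M :* M :* N :+ K 94 :* M :* N :* N :+ K 7 :* N :* N :* N :+ K 169 :* M :* M :+ K 521 :* M :* N :+ K 132 :* N :* N :+ K 511 :* M :+ K 537 :* N :+ K 508) :* e2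
      :+ (:- (K 10 :* M :* M :* M :* M :* N :+ K 14 :* M :* M :* M :* N :* N :+ K 4 :* M :* M :* N :* N :* N :+ K 10 :* M :* M :* M :* M :+ K 135 :* M :* M :* M :* N :+ K 129 :* M :* M :* N :* N :+ K 24 :* M :* N :* N :* N :+ K 131 :* M :* M :* M :+ K 684 :* M :* M :* N :+ K 393 :* M :* N :* N :+ K 34 :* N :* N :* N :+ K 639 :* M :* M :+ K 1535 :* M :* N :+ K 396 :* N :* N :+ K 1380 :* M :+ K 1286 :* N :+ K 1116) :* e3)
      :+ (M :+ K 3) :* (K 2 :* M :* N :+ K 2 :* M :+ K 5 :* N :+ K 7) :* (M :+ N :+ K 4) :* (M :+ N :+ K 3) :* e4
      :- ((M :+ K 0 :+ N) :* e1 :- (K 2 :* (M :+ K 0 :+ K 1) :* e0 :+ h :* (M :+ K 0 :+ K 2 :- N) :- d1 :- (M :+ K 0 :+ K 1) :* N :* (g1 :- c))) :* ν0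
      :- ((M :+ K 1 :+ N) :* e2 :- (K 2 :* (M :+ K 1 :+ K 1) :* e1 :+ h :* (M :+ K 1 :+ K 2 :- N) :- d2 :- (M :+ K 1 :+ K 1) :* N :* (g2 :- c))) :* ν1
      :- ((M :+ K 2 :+ N) :* e3 :- (K 2 :* (M :+ K 2 :+ K 1) :* e2 :+ h :* (M :+ K 2 :+ K 2 :- N) :- d3 :- (M :+ K 2 :+ K 1) :* N :* (g3 :- c))) :* ν2
      :- ((M :+ K 3 :+ N) :* e4 :- (K 2 :* (M :+ K 3 :+ K 1) :* e3 :+ h :* (M :+ K 3 :+ K 2 :- N) :- d4 :- (M :+ K 3 :+ K 1) :* N :* (g4 :- c))) :* ν3
      :- ((M :+ K 1 :+ N :+ K 1) :* d2 :- (M :+ K 1 :+ K 1) :* d1) :* δ1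
      :- ((M :+ K 2 :+ N :+ K 1) :* d3 :- (M :+ K 2 :+ K 1) :* d2) :* δ2
      :- ((M :+ K 3 :+ N :+ K 1) :* d4 :- (M :+ K 3 :+ K 1) :* d3) :* δ3
      :- ((M :+ K 1) :* g2 :- ((M :+ K 1) :* g1 :+ K 1)) :* η1
      :- ((M :+ K 2) :* g3 :- ((M :+ K 2) :* g2 :+ K 1)) :* η2
      :- ((M :+ K 3) :* g4 :- ((M :+ K 3) :* g3 :+ K 1)) :* η3
      :- (h :+ h :- K 1) :* θ
      := K 0)
    refl (↑ m) (↑ n) (E m n) (E (m +ℕ 1) n) (E (m +ℕ 2) n) (E (m +ℕ 3) n) (E (m +ℕ 4) n)
    (D (1 +ℕ a) b) (D (2 +ℕ a) b) (D (3 +ℕ a) b) (D (4 +ℕ a) b)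
    (H (1 +ℕ a)) (H (2 +ℕ a)) (H (3 +ℕ a)) (H (4 +ℕ a)) (H b) half)))))))))))
  where
  ↑-shift : ∀ i → ↑ m + ↑ i ≡ ↑ (i +ℕ m)
  ↑-shift i = trans (sym (↑-+ m i)) (cong ↑ (ℕ.+-comm m i))

  -- With the shift on the left, `closed (i +ℕ m) n` computes to the form that `step` expects.
  E-shift : ∀ i → E (m +ℕ i) n ≡ closed (i +ℕ m) n
  E-shift i = trans (cong (λ k → E k n) (ℕ.+-comm m i)) (E-closed (i +ℕ m) n)

  E₀ = E-closed m n
  E₁ = E-shift 1
  E₂ = E-shift 2
  E₃ = E-shift 3
  E₄ = E-shift 4

  shift : ∀ i → ↑ m + ↑ i ≡ ↑ (suc (i +ℕ a))
  shift i = trans (↑-shift i) (cong ↑ (ℕ.+-suc i a))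

  step : ∀ i {e e′} → e ≡ closed (suc (i +ℕ a)) n → e′ ≡ closed (suc (suc (i +ℕ a))) n → _
  step i = closed-suc (i +ℕ a) b (shift i) refl

  d-step : ∀ i → (↑ m + ↑ i + ↑ n + ↑ 1) * D (suc (i +ℕ a)) b ≡ (↑ m + ↑ i + ↑ 1) * D (i +ℕ a) b
  d-step i = Column.d-suc (column-left b) (i +ℕ a) (shift i) refl

  h-step : ∀ i → (↑ m + ↑ i) * H (suc (i +ℕ a)) ≡ (↑ m + ↑ i) * H (i +ℕ a) + ↑ 1
  h-step i = H-suc (i +ℕ a) (shift i)
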